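{- If $S$ is a star or a binary caterpillar, then $J(S)=1$. Moreover, every topological tree $S$ that is neither a star nor a binary caterpillar satisfies $J(S)<1$.
   Context: A topological tree is a finite rooted tree in which every non-leaf vertex has outdegree (number of children) at least $2$; the single-vertex tree is allowed, its vertex being both root and leaf. Trees are considered up to isomorphism of rooted trees (unordered, unlabelled). $|T|$ denotes the number of leaves of $T$. A nonempty set $L$ of leaves of $T$ induces a topological tree: take the smallest subtree of $T$ connecting the leaves in $L$, rooted at the most recent common ancestor of $L$, and suppress (erase, joining the neighbours) all vertices of outdegree $1$. For topological trees $S,T$, $c(S,T)$ is the number of subsets of the leaf set of $T$ whose induced tree is isomorphic, as a rooted tree, to $S$, and $\gamma(S,T)=c(S,T)/\binom{|T|}{|S|}$ (for $|T|\ge |S|$). The inducibility of $S$ is $$J(S)=\limsup_{n\to\infty}\ \max_{\substack{|T|=n\\ T\text{ topological tree}}}\gamma(S,T).$$ A star is a topological tree in which all leaves are children of the root. A binary tree is a topological tree in which every vertex has outdegree at most $2$ (so every non-leaf vertex has exactly two children). A binary caterpillar is a binary tree whose non-leaf vertices all lie on a single path starting at the root (the single-vertex tree counts as a binary caterpillar). -}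

module Defs where

open import Data.Fin.Base using (Fin)
open import Data.Fin.Subset using (Subset; inside; outside)
open import Data.Integer.Base using (+_)
open import Data.List.Base as List
  using (List; []; _∷_; _++_; length; map; filter; cartesianProductWith)
open import Data.List.Membership.Propositional using (_∈_)
open import Data.List.Membership.Propositional.Properties
  using (∈-cartesianProductWith⁺; ∈-filter⁺; ∈-filter⁻; ∈-map⁺; ∈-map⁻)
open import Data.List.Relation.Binary.Permutation.Homogeneous as Perm
  using (Permutation; prep; swap)
open import Data.List.Relation.Binary.Pointwise.Base as Pointwise
  using (Pointwise; []; _∷_)
open import Data.List.Relation.Unary.All as All using (All; []; _∷_)
open import Data.List.Relation.Unary.Any using (Any; here; there; any?)
open import Data.Maybe.Base using (Maybe; just; nothing)
import Data.Maybe.Relation.Unary.Any as Maybe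
open import Data.Nat.Base as ℕ using (ℕ; zero; suc; _+_; z≤n; s≤s)
open import Data.Nat.Combinatorics using (_C_)
import Data.Nat.Properties as ℕₚ
open import Data.Product.Base using (Σ; ∃; ∃-syntax; _×_; _,_; proj₂)
open import Data.Rational.Base as ℚ using (ℚ; 0ℚ; _/_)
import Data.Rational.Properties as ℚₚ
open import Data.Sum.Base using (_⊎_; inj₁; inj₂)
open import Data.Vec.Base as Vec
  using (Vec; []; _∷_; lookup; toList; fromList; take; drop)
open import Function.Bundles using (_⇔_)
open import Relation.Binary.Bundles using (Setoid; DecTotalOrder)
open import Relation.Binary.PropositionalEquality
  using (_≡_; refl; sym; cong; subst)
open import Relation.Nullary.Decidable using (Dec; yes; no; map′)
open import Relation.Nullary.Negation using (¬_)

import Data.List.Extrema (DecTotalOrder.totalOrder ℚₚ.≤-decTotalOrder) as Extrema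

------------------------------------------------------------------------
-- Topological trees

-- The children are stored in some order, which _≅_ below disregards.

data Tree : Set where
  leaf : Tree
  node : ∀ {k} → Vec Tree (2 + k) → Tree

mutual
  ∣_∣ : Tree → ℕ
  ∣ leaf    ∣ = 1
  ∣ node ts ∣ = ∣ ts ∣*

  ∣_∣* : ∀ {n} → Vec Tree n → ℕ
  ∣ []     ∣* = 0
  ∣ t ∷ ts ∣* = ∣ t ∣ + ∣ ts ∣*

-- Isomorphism of rooted trees: the children of the two roots correspond
-- bijectively, corresponding children carrying isomorphic subtrees.

infix 4 _≅_

data _≅_ : Tree → Tree → Set where
  leaf : leaf ≅ leaf
  node : ∀ {k l} {ts : Vec Tree (2 + k)} {us : Vec Tree (2 + l)} →
         Permutation _≅_ (toList ts) (toList us) → node ts ≅ node us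

mutual
  ≅-refl : ∀ {t} → t ≅ t
  ≅-refl {leaf}    = leaf
  ≅-refl {node ts} = node (Perm.refl (≅*-refl ts))

  ≅*-refl : ∀ {n} (ts : Vec Tree n) → Pointwise _≅_ (toList ts) (toList ts)
  ≅*-refl []       = []
  ≅*-refl (t ∷ ts) = ≅-refl ∷ ≅*-refl ts

mutual
  ≅-sym : ∀ {t u} → t ≅ u → u ≅ t
  ≅-sym leaf     = leaf
  ≅-sym (node p) = node (↭-sym p)

  ↭-sym : ∀ {ts us} → Permutation _≅_ ts us → Permutation _≅_ us ts
  ↭-sym (Perm.refl es)   = Perm.refl (≅*-sym es)
  ↭-sym (prep e p)       = prep (≅-sym e) (↭-sym p)
  ↭-sym (swap e f p)     = swap (≅-sym f) (≅-sym e) (↭-sym p)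
  ↭-sym (Perm.trans p q) = Perm.trans (↭-sym q) (↭-sym p)

  ≅*-sym : ∀ {ts us} → Pointwise _≅_ ts us → Pointwise _≅_ us ts
  ≅*-sym []       = []
  ≅*-sym (e ∷ es) = ≅-sym e ∷ ≅*-sym es

≅-trans : ∀ {t u v} → t ≅ u → u ≅ v → t ≅ v
≅-trans leaf     leaf     = leaf
≅-trans (node p) (node q) = node (Perm.trans p q)

≅-setoid : Setoid _ _
≅-setoid = record
  { Carrier       = Tree
  ; _≈_           = _≅_
  ; isEquivalence = record { refl = ≅-refl ; sym = ≅-sym ; trans = ≅-trans }
  }

open import Data.List.Relation.Binary.Permutation.Setoid ≅-setoid
  using (_↭_; ↭-refl; ↭-trans)
open import Data.List.Relation.Binary.Permutation.Setoid.Properties ≅-setoid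
  using (shift; drop-∷; ∈-resp-↭; ¬x∷xs↭[])

private
  anySplit : ∀ {P : Tree → Set} {ts} → Any P ts →
             ∃ λ ps → ∃ λ t → ∃ λ qs → P t × ts ≡ ps ++ t ∷ qs
  anySplit (here p)  = [] , _ , _ , p , refl
  anySplit (there a) with anySplit a
  ... | ps , t , qs , p , refl = _ ∷ ps , t , qs , p , refl

infix 4 _≅?_

mutual
  _≅?_ : (t u : Tree) → Dec (t ≅ u)
  leaf    ≅? leaf    = yes leaf
  leaf    ≅? node _  = no λ ()
  node _  ≅? leaf    = no λ ()
  node ts ≅? node us = map′ node (λ { (node p) → p }) (ts ↭? toList us)

  _↭?_ : ∀ {n} (ts : Vec Tree n) (us : List Tree) → Dec (toList ts ↭ us)
  []       ↭? []      = yes ↭-refl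
  []       ↭? (_ ∷ _) = no λ p → ¬x∷xs↭[] (↭-sym p)
  (t ∷ ts) ↭? us with any? (t ≅?_) us
  ... | no  t∉us = no λ p → t∉us (∈-resp-↭ p (here ≅-refl))
  ... | yes t∈us with anySplit t∈us
  ...   | ps , u , qs , t≅u , refl with ts ↭? (ps ++ qs)
  ...     | yes p = yes (↭-trans (prep t≅u p) (↭-sym (shift ≅-refl ps qs)))
  ...     | no ¬p = no λ q → ¬p (drop-∷ (↭-trans q (shift (≅-sym t≅u) ps qs)))

------------------------------------------------------------------------
-- Vertices, stars and binary caterpillars

data Vertex : Tree → Set where
  root  : ∀ {t} → Vertex t
  below : ∀ {k} {ts : Vec Tree (2 + k)} (i : Fin (2 + k)) →
          Vertex (lookup ts i) → Vertex (node ts)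

subtreeAt : ∀ {t} → Vertex t → Tree
subtreeAt {t} root    = t
subtreeAt (below _ v) = subtreeAt v

rootDegree : Tree → ℕ
rootDegree leaf         = 0
rootDegree (node {k} _) = 2 + k

outdegree : ∀ {t} → Vertex t → ℕ
outdegree v = rootDegree (subtreeAt v)

IsLeaf : ∀ {t} → Vertex t → Set
IsLeaf v = outdegree v ≡ 0

data ChildOfRoot : ∀ {t} → Vertex t → Set where
  child : ∀ {k} {ts : Vec Tree (2 + k)} (i : Fin (2 + k)) →
          ChildOfRoot (below {ts = ts} i root)

-- v ≼ w: the vertex v lies on the path from the root to w.

infix 4 _≼_

data _≼_ : ∀ {t} → Vertex t → Vertex t → Set where
  root  : ∀ {t} {w : Vertex t} → root ≼ w
  below : ∀ {k} {ts : Vec Tree (2 + k)} {i} {v w : Vertex (lookup ts i)} →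
          v ≼ w → below {ts = ts} i v ≼ below i w

Star : Tree → Set
Star t = (v : Vertex t) → IsLeaf v → ChildOfRoot v

Binary : Tree → Set
Binary t = (v : Vertex t) → outdegree v ℕ.≤ 2

BinaryCaterpillar : Tree → Set
BinaryCaterpillar t =
  Binary t × ∃[ w ] ((v : Vertex t) → ¬ IsLeaf v → v ≼ w)

------------------------------------------------------------------------
-- Induced trees

-- The leaves of t are numbered from left to right, so that Subset ∣ t ∣ is
-- the type of sets of leaves of t.  The subtrees of a vertex that contain
-- no selected leaf are removed.  A vertex left with exactly one child is
-- replaced by that child: it is either a proper ancestor of the most recent
-- common ancestor of the selected leaves, hence outside of the subtree they
-- span, or a vertex of outdegree 1 of that subtree, hence suppressed.
-- The result is nothing precisely for the empty set of leaves.

join : List Tree → Maybe Tree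
join []           = nothing
join (t ∷ [])     = just t
join (t ∷ u ∷ ts) = just (node (t ∷ u ∷ fromList ts))

mutual
  induced : (t : Tree) → Subset ∣ t ∣ → Maybe Tree
  induced leaf      (inside  ∷ []) = just leaf
  induced leaf      (outside ∷ []) = nothing
  induced (node ts) L              = join (inducedForest ts L)

  inducedForest : ∀ {n} (ts : Vec Tree n) → Subset ∣ ts ∣* → List Tree
  inducedForest []       _ = []
  inducedForest (t ∷ ts) L =
    List.fromMaybe (induced t (take ∣ t ∣ L)) ++
    inducedForest ts (drop ∣ t ∣ L)

Induces : (t : Tree) → Subset ∣ t ∣ → Tree → Set
Induces t L s = Maybe.Any (_≅ s) (induced t L)

induces? : ∀ t s (L : Subset ∣ t ∣) → Dec (Induces t L s)
induces? t s L = Maybe.dec (_≅? s) (induced t L)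

subsets : ∀ n → List (Subset n)
subsets zero    = [] ∷ []
subsets (suc n) = map (outside ∷_) (subsets n) ++ map (inside ∷_) (subsets n)

c : Tree → Tree → ℕ
c s t = length (filter (induces? t s) (subsets ∣ t ∣))

-- The quotient c s t / (∣ t ∣ C ∣ s ∣).  The denominator vanishes precisely
-- when ∣ t ∣ < ∣ s ∣; the value is then 0 by convention.

γ : Tree → Tree → ℚ
γ s t with ∣ t ∣ C ∣ s ∣
... | zero  = 0ℚ
... | suc d = + c s t / suc d

------------------------------------------------------------------------
-- The maximum of γ over all trees with n leaves

-- listsUpTo m xs contains the lists of length at most m with entries in xs.

listsUpTo : ∀ {A : Set} → ℕ → List A → List (List A)
listsUpTo zero    xs = [] ∷ []
listsUpTo (suc m) xs = [] ∷ cartesianProductWith _∷_ xs (listsUpTo m xs)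

fromForest : List Tree → Tree
fromForest (t ∷ u ∷ ts) = node (t ∷ u ∷ fromList ts)
fromForest _            = leaf

-- boundedTrees h m contains the trees of height at most h in which every
-- outdegree is at most m.

boundedTrees : ℕ → ℕ → List Tree
boundedTrees zero    m = leaf ∷ []
boundedTrees (suc h) m = map fromForest (listsUpTo m (boundedTrees h m))

trees : ℕ → List Tree
trees n = filter (λ t → ∣ t ∣ ℕₚ.≟ n) (boundedTrees n n)

maxγ : Tree → ℕ → ℚ
maxγ s n = Extrema.max 0ℚ (map (γ s) (trees n))

private
  ∣t∣>0 : ∀ t → 0 ℕ.< ∣ t ∣
  ∣t∣>0 leaf           = s≤s z≤n
  ∣t∣>0 (node (t ∷ _)) = ℕₚ.≤-trans (∣t∣>0 t) (ℕₚ.m≤m+n _ _)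

  n≤∣ts∣* : ∀ {n} (ts : Vec Tree n) → n ℕ.≤ ∣ ts ∣*
  n≤∣ts∣* []       = z≤n
  n≤∣ts∣* (t ∷ ts) = ℕₚ.+-mono-≤ (∣t∣>0 t) (n≤∣ts∣* ts)

  ∈-listsUpTo : ∀ {A : Set} {m n} {xs : List A} (ys : Vec A n) → n ℕ.≤ m →
                All (_∈ xs) (toList ys) → toList ys ∈ listsUpTo m xs
  ∈-listsUpTo {m = zero}  []       _         _        = here refl
  ∈-listsUpTo {m = suc m} []       _         _        = here refl
  ∈-listsUpTo {m = suc m} (y ∷ ys) (s≤s n≤m) (p ∷ ps) =
    there (∈-cartesianProductWith⁺ _∷_ p (∈-listsUpTo ys n≤m ps))

  fromForest-toList : ∀ {k} (ts : Vec Tree (2 + k)) →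
                      node ts ≡ fromForest (toList ts)
  fromForest-toList (t ∷ u ∷ ts) = node-cong ts
    where
    node-cong : ∀ {k} (ts : Vec Tree k) →
                node (t ∷ u ∷ ts) ≡ node (t ∷ u ∷ fromList (toList ts))
    node-cong ts = cong (λ { (_ , vs) → node (t ∷ u ∷ vs) }) (lemma ts)
      where
      lemma : ∀ {k} (vs : Vec Tree k) →
              _≡_ {A = Σ ℕ (Vec Tree)} (k , vs)
                  (length (toList vs) , fromList (toList vs))
      lemma []       = refl
      lemma (v ∷ vs) = cong (λ { (_ , ws) → _ , v ∷ ws }) (lemma vs)

  -- A child of a vertex with at least two children has fewer leaves than
  -- that vertex, hence the height is less than the number of leaves.
  mutual
    ∈-bounded : ∀ {m} h t → ∣ t ∣ ℕ.≤ suc h → ∣ t ∣ ℕ.≤ m →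
                t ∈ boundedTrees h m
    ∈-bounded zero leaf _ _ = here refl
    ∈-bounded {zero}  (suc h) leaf _ _ = here refl
    ∈-bounded {suc m} (suc h) leaf _ _ = here refl
    ∈-bounded zero (node ts) ≤1 _ with ℕₚ.≤-trans (n≤∣ts∣* ts) ≤1
    ... | s≤s ()
    ∈-bounded {m} (suc h) (node ts@(t ∷ ts′)) ≤h ≤m =
      subst (_∈ boundedTrees (suc h) m) (sym (fromForest-toList ts))
        (∈-map⁺ fromForest (∈-listsUpTo ts
          (ℕₚ.≤-trans (n≤∣ts∣* ts) ≤m)
          (∈-bounded h t
             (ℕₚ.≤-pred (ℕₚ.≤-trans
               (ℕₚ.≤-trans (ℕₚ.≤-reflexive (ℕₚ.+-comm 1 ∣ t ∣))
                 (ℕₚ.+-monoʳ-≤ ∣ t ∣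
                   (ℕₚ.≤-trans (s≤s z≤n) (n≤∣ts∣* ts′)))) ≤h))
             (ℕₚ.≤-trans (ℕₚ.m≤m+n _ _) ≤m)
           ∷ ∈-bounded* h ts′
             (ℕₚ.≤-pred (ℕₚ.≤-trans (ℕₚ.+-monoˡ-≤ _ (∣t∣>0 t)) ≤h))
             (ℕₚ.≤-trans (ℕₚ.m≤n+m _ ∣ t ∣) ≤m))))

    ∈-bounded* : ∀ {m n} h (ts : Vec Tree n) →
                 ∣ ts ∣* ℕ.≤ suc h → ∣ ts ∣* ℕ.≤ m →
                 All (_∈ boundedTrees h m) (toList ts)
    ∈-bounded* h []       _  _  = []
    ∈-bounded* h (t ∷ ts) ≤h ≤m =
      ∈-bounded h t (ℕₚ.≤-trans (ℕₚ.m≤m+n _ _) ≤h)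
                    (ℕₚ.≤-trans (ℕₚ.m≤m+n _ _) ≤m)
      ∷ ∈-bounded* h ts (ℕₚ.≤-trans (ℕₚ.m≤n+m _ ∣ t ∣) ≤h)
                        (ℕₚ.≤-trans (ℕₚ.m≤n+m _ ∣ t ∣) ≤m)

  starWith : ℕ → Tree
  starWith zero    = leaf
  starWith (suc k) = node (Vec.replicate (2 + k) leaf)

  ∣starWith∣ : ∀ k → ∣ starWith k ∣ ≡ suc k
  ∣starWith∣ zero    = refl
  ∣starWith∣ (suc k) = cong (λ m → suc (suc m)) (leaves k)
    where
    leaves : ∀ k → ∣ Vec.replicate k leaf ∣* ≡ k
    leaves zero    = refl
    leaves (suc k) = cong suc (leaves k)

∈-trees⁺ : ∀ t → t ∈ trees ∣ t ∣
∈-trees⁺ t =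
  ∈-filter⁺ (λ u → ∣ u ∣ ℕₚ.≟ ∣ t ∣) (∈-bounded ∣ t ∣ t (ℕₚ.n≤1+n _) ℕₚ.≤-refl) refl

∈-trees⁻ : ∀ {n t} → t ∈ trees n → ∣ t ∣ ≡ n
∈-trees⁻ {n} t∈ =
  proj₂ (∈-filter⁻ (λ t → ∣ t ∣ ℕₚ.≟ n) {xs = boundedTrees n n} t∈)

γ≥0 : ∀ s t → 0ℚ ℚ.≤ γ s t
γ≥0 s t with ∣ t ∣ C ∣ s ∣
... | zero  = ℚₚ.≤-refl
... | suc d = ℚₚ.nonNegative⁻¹ _ {{ℚₚ.normalize-nonNeg (c s t) (suc d)}}

γ≤maxγ : ∀ s t → γ s t ℚ.≤ maxγ s ∣ t ∣
γ≤maxγ s t = All.lookup (Extrema.xs≤max 0ℚ _) (∈-map⁺ (γ s) (∈-trees⁺ t))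

maxγ-attained : ∀ s n → ∃[ t ] (∣ t ∣ ≡ suc n × γ s t ≡ maxγ s (suc n))
maxγ-attained s n
  with Extrema.argmax-sel (λ q → q) 0ℚ (map (γ s) (trees (suc n)))
... | inj₂ q∈ with ∈-map⁻ (γ s) q∈
...   | t , t∈ , eq = t , ∈-trees⁻ t∈ , sym eq
maxγ-attained s n | inj₁ eq = t₀ , ∣starWith∣ n , ℚₚ.≤-antisym
  (subst (λ m → γ s t₀ ℚ.≤ maxγ s m) (∣starWith∣ n) (γ≤maxγ s t₀))
  (subst (ℚ._≤ γ s t₀) (sym eq) (γ≥0 s t₀))
  where t₀ = starWith n

------------------------------------------------------------------------
-- Limits superior

-- An extended real number x, given by the rationals q with q < x and those
-- with x < q.  The limit superior of a sequence is in general not a located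
-- (Dedekind) real constructively, so locatedness is not required.

record Cut : Set₁ where
  field
    Lower : ℚ → Set
    Upper : ℚ → Set

open Cut public

fromℚ : ℚ → Cut
fromℚ p = record { Lower = ℚ._< p ; Upper = p ℚ.<_ }

infix 4 _≈_ _<_

_≈_ : Cut → Cut → Set
x ≈ y = (∀ q → Lower x q ⇔ Lower y q) × (∀ q → Upper x q ⇔ Upper y q)

_<_ : Cut → Cut → Set
x < y = ∃[ q ] (Upper x q × Lower y q)

limsup : (ℕ → ℚ) → Cut
limsup a = record
  { Lower = λ q → ∃[ r ] (q ℚ.< r × (∀ N → ∃[ n ] (N ℕ.≤ n × r ℚ.≤ a n)))
  ; Upper = λ q → ∃[ r ] (r ℚ.< q × ∃[ N ] (∀ n → N ℕ.≤ n → a n ℚ.≤ r))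
  }

J : Tree → Cut
J s = limsup (maxγ s)

{-# OPTIONS --safe #-}
-- Every tree induced by a star or a binary caterpillar has the same shape, so
-- the density of such an S is 1 in large stars or caterpillars.
--
-- Conversely, let |S| = k = m + 2.  A set of more than (m + 1)^d leaves of a
-- tree contains a set inducing the star with m + 2 leaves or the caterpillar
-- with d + 1 leaves: either many branches at a vertex meet the set, or one of
-- them contains a large part of it and a further leaf lies outside of that
-- branch.  For d = m + 1 both have k leaves, so if S is neither, then every
-- set of N = (m + 1)^(m + 1) + k leaves contains a k-set that does not induce
-- S.  By double counting, at least a fraction 1 / (N C k) of all k-sets in a
-- tree with at least N leaves do not induce S.
module Submission where

open import Defs
open import Data.Product using (_×_)
open import Data.Sum using (_⊎_)
open import Data.Rational using (1ℚ)
open import Relation.Nullary using (¬_)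

open import Data.Bool.Base as Bool using (Bool; true; false; if_then_else_; b≤b; f≤t)
import Data.Bool.Properties as Boolₚ
open import Data.Fin.Base using (zero; suc)
open import Data.Fin.Subset as Subset using (Subset; inside; outside; ∁)
open import Data.Fin.Subset.Properties using (∣∁p∣≡n∸∣p∣; ∣p∣≤n)
import Data.Integer.Base as ℤ
import Data.Integer.Properties as ℤₚ
open import Data.List.Base as List using (List; []; _∷_; length; filter; map)
open import Data.List.Properties using (filter-++; length-++)
open import Data.List.Relation.Binary.Permutation.Homogeneous as Perm
  using (Permutation; prep; swap)
import Data.List.Relation.Binary.Permutation.Setoid.Properties as Permₚ
import Data.List.Relation.Binary.Pointwise.Base as PW
open import Data.List.Relation.Unary.All using (All; []; _∷_)
open import Data.List.Relation.Unary.Any using (here; there)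
open import Data.Maybe.Base using (Maybe; just; nothing; maybe′)
import Data.Maybe.Relation.Unary.Any as Maybe
open import Data.Nat.Base as ℕ
  using (ℕ; zero; suc; _+_; _*_; _∸_; _^_; _≤_; z≤n; s≤s; >-nonZero)
open import Data.Nat.Combinatorics
  using (_C_; nCn≡1; nCk≡nC[n∸k]; nCk+nC[k+1]≡[n+1]C[k+1]; k>n⇒nCk≡0)
open import Data.Nat.ListAction using (sum)
open import Data.Nat.Properties
open import Data.Nat.Solver using (module +-*-Solver)
open import Data.Product using (∃-syntax; ∃₂; _,_; proj₁)
open import Data.Rational using (_/_)
import Data.Rational.Base as ℚ
import Data.Rational.Properties as ℚₚ
open import Data.Rational.Unnormalised.Base using (mkℚᵘ; *≤*; *<*)
import Data.Rational.Unnormalised.Properties as ℚᵘₚ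
open import Data.Sum as Sum using (inj₁; inj₂)
open import Data.Vec.Base as Vec
  using (Vec; []; _∷_; toList; fromList; lookup; _++_)
open import Data.Vec.Properties
  using (toList-replicate; toList∘fromList; lookup-replicate; take++drop≡id; ++-injective)
open import Data.Vec.Relation.Binary.Pointwise.Inductive as Pointwise
  using (Pointwise; []; _∷_)
open import Function.Base using (_∘_; id; case_of_)
open import Function.Bundles using (mk⇔)
open import Relation.Binary.PropositionalEquality
  using (_≡_; refl; sym; trans; cong; cong₂; subst; subst₂; module ≡-Reasoning)
open import Relation.Nullary using (Dec; yes; no; does; contradiction; _×-dec_; ¬?)
open import Relation.Unary using (Decidable)

-- Counting subsets

♯_ : ∀ {n} → Subset n → ℕ
♯_ = Subset.∣_∣

𝟙 : {P : Set} → Dec P → ℕ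
𝟙 d = if does d then 1 else 0

𝟙-yes : {P : Set} (d : Dec P) → P → 𝟙 d ≡ 1
𝟙-yes (yes _) _ = refl
𝟙-yes (no ¬p) p = contradiction p ¬p

𝟙-no : {P : Set} (d : Dec P) → ¬ P → 𝟙 d ≡ 0
𝟙-no (yes p) ¬p = contradiction p ¬p
𝟙-no (no _)  _  = refl

-- The recursion branches on the first element, so that the counts below reduce to Pascal's rule.
∑ : ∀ n → (Subset n → ℕ) → ℕ
∑ zero    f = f []
∑ (suc n) f = ∑ n (f ∘ (outside ∷_)) + ∑ n (f ∘ (inside ∷_))

∑-cong : ∀ n {f g : Subset n → ℕ} → (∀ L → f L ≡ g L) → ∑ n f ≡ ∑ n g
∑-cong zero    eq = eq []
∑-cong (suc n) eq =
  cong₂ _+_ (∑-cong n (eq ∘ (outside ∷_))) (∑-cong n (eq ∘ (inside ∷_)))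

∑-mono : ∀ n {f g : Subset n → ℕ} → (∀ L → f L ≤ g L) → ∑ n f ≤ ∑ n g
∑-mono zero    le = le []
∑-mono (suc n) le =
  +-mono-≤ (∑-mono n (le ∘ (outside ∷_))) (∑-mono n (le ∘ (inside ∷_)))

∑-zero : ∀ n {f : Subset n → ℕ} → (∀ L → f L ≡ 0) → ∑ n f ≡ 0
∑-zero zero    eq = eq []
∑-zero (suc n) eq =
  cong₂ _+_ (∑-zero n (eq ∘ (outside ∷_))) (∑-zero n (eq ∘ (inside ∷_)))

∑-distrib-+ : ∀ n (f g : Subset n → ℕ) →
              ∑ n (λ L → f L + g L) ≡ ∑ n f + ∑ n g
∑-distrib-+ zero    f g = refl
∑-distrib-+ (suc n) f g = trans
  (cong₂ _+_ (∑-distrib-+ n _ _) (∑-distrib-+ n _ _))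
  (solve 4 (λ a b c d → (a :+ b) :+ (c :+ d) := (a :+ c) :+ (b :+ d)) refl
    (∑ n (f ∘ (outside ∷_))) (∑ n (g ∘ (outside ∷_)))
    (∑ n (f ∘ (inside ∷_)))  (∑ n (g ∘ (inside ∷_))))
  where open +-*-Solver

∑-distribˡ-* : ∀ n a (f : Subset n → ℕ) → ∑ n (λ L → a * f L) ≡ a * ∑ n f
∑-distribˡ-* zero    a f = refl
∑-distribˡ-* (suc n) a f = trans
  (cong₂ _+_ (∑-distribˡ-* n a _) (∑-distribˡ-* n a _))
  (sym (*-distribˡ-+ a (∑ n (f ∘ (outside ∷_))) (∑ n (f ∘ (inside ∷_)))))

∑-distribʳ-* : ∀ n a (f : Subset n → ℕ) → ∑ n (λ L → f L * a) ≡ ∑ n f * a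
∑-distribʳ-* n a f = trans
  (∑-cong n (λ L → *-comm (f L) a))
  (trans (∑-distribˡ-* n a f) (*-comm a (∑ n f)))

∑-swap : ∀ m n (f : Subset m → Subset n → ℕ) →
         ∑ m (λ L → ∑ n (f L)) ≡ ∑ n (λ M → ∑ m (λ L → f L M))
∑-swap zero    n f = refl
∑-swap (suc m) n f = trans
  (cong₂ _+_ (∑-swap m n _) (∑-swap m n _))
  (sym (∑-distrib-+ n _ _))

term≤∑ : ∀ n (f : Subset n → ℕ) L → f L ≤ ∑ n f
term≤∑ zero    f []            = ≤-refl
term≤∑ (suc n) f (outside ∷ L) = m≤n⇒m≤n+o _ (term≤∑ n (f ∘ (outside ∷_)) L)
term≤∑ (suc n) f (inside ∷ L)  = m≤n⇒m≤o+n _ (term≤∑ n (f ∘ (inside ∷_)) L)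

length-filter-map : {A B : Set} {P : B → Set} (P? : Decidable P) (f : A → B) →
                    ∀ xs → length (filter P? (map f xs)) ≡ length (filter (P? ∘ f) xs)
length-filter-map P? f []       = refl
length-filter-map P? f (x ∷ xs) with does (P? (f x))
... | true  = cong suc (length-filter-map P? f xs)
... | false = length-filter-map P? f xs

-- The link between `c`, which filters a list of subsets, and the recursive sums used for counting.
length-filter-subsets : ∀ n {P : Subset n → Set} (P? : Decidable P) →
                        length (filter P? (subsets n)) ≡ ∑ n (𝟙 ∘ P?)
length-filter-subsets zero    P? with does (P? [])
... | true  = refl
... | false = refl
length-filter-subsets (suc n) P? = begin
  length (filter P? (extend outside List.++ extend inside))
    ≡⟨ cong length (filter-++ P? (extend outside) _) ⟩
  length (filter P? (extend outside) List.++ filter P? (extend inside))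
    ≡⟨ length-++ (filter P? (extend outside)) ⟩
  length (filter P? (extend outside)) + length (filter P? (extend inside))
    ≡⟨ cong₂ _+_ (half outside) (half inside) ⟩
  ∑ (suc n) (𝟙 ∘ P?) ∎
  where
  open ≡-Reasoning
  extend : Bool → List (Subset (suc n))
  extend b = map (b ∷_) (subsets n)

  half : ∀ b → length (filter P? (extend b)) ≡ ∑ n (𝟙 ∘ P? ∘ (b ∷_))
  half b = trans (length-filter-map P? (b ∷_) (subsets n))
                 (length-filter-subsets n (P? ∘ (b ∷_)))

-- Pointwise rather than by membership of elements, so that deciding M ⊑ L
-- computes by recursion on the vectors, like ∑.

infix 4 _⊑_ _⊑?_

_⊑_ : ∀ {n} → Subset n → Subset n → Set
_⊑_ = Pointwise Bool._≤_

_⊑?_ : ∀ {n} (M L : Subset n) → Dec (M ⊑ L)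
_⊑?_ = Pointwise.decidable Boolₚ._≤?_

⊑⇒♯≤ : ∀ {n} {M L : Subset n} → M ⊑ L → ♯ M ≤ ♯ L
⊑⇒♯≤ []                = z≤n
⊑⇒♯≤ (f≤t ∷ p)         = m≤n⇒m≤1+n (⊑⇒♯≤ p)
⊑⇒♯≤ (b≤b {false} ∷ p) = ⊑⇒♯≤ p
⊑⇒♯≤ (b≤b {true}  ∷ p) = s≤s (⊑⇒♯≤ p)

-- Binomial coefficients as numbers of subsets

nC0≡1 : ∀ n → n C 0 ≡ 1
nC0≡1 n = trans (nCk≡nC[n∸k] {0} {n} z≤n) (nCn≡1 n)

∑-size : ∀ n k → ∑ n (λ L → 𝟙 (♯ L ≟ k)) ≡ n C k
∑-size zero    zero    = refl
∑-size zero    (suc k) = sym (k>n⇒nCk≡0 {0} {suc k} (s≤s z≤n))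
∑-size (suc n) zero    = trans
  (cong₂ _+_ (trans (∑-size n 0) (nC0≡1 n)) (∑-zero n (λ _ → refl)))
  (sym (nC0≡1 (suc n)))
∑-size (suc n) (suc k) = trans
  (cong₂ _+_ (∑-size n (suc k)) (∑-size n k))
  (trans (+-comm (n C suc k) (n C k)) (nCk+nC[k+1]≡[n+1]C[k+1] n k))

-- An element outside of `L` cannot be chosen; each element of `L` gives one step of Pascal's rule.
∑-below : ∀ {n} (L : Subset n) k →
          ∑ n (λ M → 𝟙 (M ⊑? L) * 𝟙 (♯ M ≟ k)) ≡ (♯ L) C k
∑-below []            zero    = refl
∑-below []            (suc k) = sym (k>n⇒nCk≡0 {0} {suc k} (s≤s z≤n))
∑-below {suc n} (outside ∷ L) k = trans
  (cong₂ _+_ (∑-below L k) (∑-zero n (λ _ → refl))) (+-identityʳ _)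
∑-below {suc n} (inside ∷ L) zero = trans
  (cong₂ _+_ (trans (∑-below L 0) (nC0≡1 (♯ L)))
             (∑-zero n (λ M → *-zeroʳ (𝟙 (M ⊑? L)))))
  (sym (nC0≡1 (suc (♯ L))))
∑-below {suc n} (inside ∷ L) (suc k) = trans
  (cong₂ _+_ (∑-below L (suc k)) (∑-below L k))
  (trans (+-comm ((♯ L) C suc k) ((♯ L) C k)) (nCk+nC[k+1]≡[n+1]C[k+1] (♯ L) k))

-- Dually, the elements of `M` are forced, and the other `j` elements are chosen from the complement
-- of `M`.
∑-above : ∀ {n} (M : Subset n) j →
          ∑ n (λ L → 𝟙 (M ⊑? L) * 𝟙 (♯ L ≟ j + ♯ M)) ≡ (♯ ∁ M) C j
∑-above []            zero    = refl
∑-above []            (suc j) = sym (k>n⇒nCk≡0 {0} {suc j} (s≤s z≤n))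
∑-above {suc n} (inside ∷ M) j = trans
  (cong₂ _+_ (∑-zero n (λ _ → refl))
    (∑-cong n (λ L → cong (λ m → 𝟙 (M ⊑? L) * 𝟙 (suc (♯ L) ≟ m)) (+-suc j (♯ M)))))
  (∑-above M j)
∑-above {suc n} (outside ∷ M) zero = trans
  (cong₂ _+_ (trans (∑-above M 0) (nC0≡1 (♯ ∁ M))) (∑-zero n too-large))
  (sym (nC0≡1 (suc (♯ ∁ M))))
  where
  -- A superset of `M` with one further element has more than `♯ M` elements.
  too-large : ∀ L → 𝟙 (M ⊑? L) * 𝟙 (suc (♯ L) ≟ ♯ M) ≡ 0
  too-large L with M ⊑? L
  ... | no _    = refl
  ... | yes M⊑L = cong (1 *_) (𝟙-no (suc (♯ L) ≟ ♯ M)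
                    (λ eq → 1+n≰n (≤-trans (≤-reflexive eq) (⊑⇒♯≤ M⊑L))))
∑-above {suc n} (outside ∷ M) (suc j) = trans
  (cong₂ _+_ (∑-above M (suc j)) (∑-above M j))
  (trans (+-comm ((♯ ∁ M) C suc j) ((♯ ∁ M) C j)) (nCk+nC[k+1]≡[n+1]C[k+1] (♯ ∁ M) j))

-- In this form the count depends on `M` only through its size, so it can be taken out of a sum over
-- sets of size `k`.
∑-above′ : ∀ {n k} (M : Subset n) j → ♯ M ≡ k →
           ∑ n (λ L → 𝟙 (M ⊑? L) * 𝟙 (♯ L ≟ j + k)) ≡ (n ∸ k) C j
∑-above′ M j refl = trans (∑-above M j) (cong (_C j) (∣∁p∣≡n∸∣p∣ M))

-- Double counting

𝟙-guard : {P : Set} (d : Dec P) {a b : ℕ} → (P → a ≡ b) → 𝟙 d * a ≡ 𝟙 d * b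
𝟙-guard (yes p) eq = cong (1 *_) (eq p)
𝟙-guard (no _)  _  = refl

𝟙≤𝟙* : {P : Set} (d : Dec P) {b : ℕ} → (P → 1 ≤ b) → 𝟙 d ≤ 𝟙 d * b
𝟙≤𝟙* (yes p) 1≤b = ≤-trans (1≤b p) (≤-reflexive (sym (*-identityˡ _)))
𝟙≤𝟙* (no _)  _   = z≤n

module _ {n k j : ℕ} {P : Subset n → Set}
         (P? : Decidable P) (P⇒♯ : ∀ {M} → P M → ♯ M ≡ k) where

  -- Double counting of the pairs M ⊑ L with ♯ L = j + k and P M.
  ∑-pairs : ∑ n (λ L → 𝟙 (♯ L ≟ j + k) * ∑ n (λ M → 𝟙 (M ⊑? L) * 𝟙 (P? M)))
            ≡ ∑ n (𝟙 ∘ P?) * ((n ∸ k) C j)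
  ∑-pairs = begin
    ∑ n (λ L → 𝟙 (♯ L ≟ j + k) * ∑ n (λ M → 𝟙 (M ⊑? L) * 𝟙 (P? M)))
      ≡⟨ ∑-cong n (λ L → sym (∑-distribˡ-* n (𝟙 (♯ L ≟ j + k)) _)) ⟩
    ∑ n (λ L → ∑ n (λ M → 𝟙 (♯ L ≟ j + k) * (𝟙 (M ⊑? L) * 𝟙 (P? M))))
      ≡⟨ ∑-swap n n _ ⟩
    ∑ n (λ M → ∑ n (λ L → 𝟙 (♯ L ≟ j + k) * (𝟙 (M ⊑? L) * 𝟙 (P? M))))
      ≡⟨ ∑-cong n above ⟩
    ∑ n (λ M → 𝟙 (P? M) * ((n ∸ k) C j))
      ≡⟨ ∑-distribʳ-* n ((n ∸ k) C j) (𝟙 ∘ P?) ⟩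
    ∑ n (𝟙 ∘ P?) * ((n ∸ k) C j) ∎
    where
    open ≡-Reasoning
    open +-*-Solver
    above : ∀ M → ∑ n (λ L → 𝟙 (♯ L ≟ j + k) * (𝟙 (M ⊑? L) * 𝟙 (P? M)))
                  ≡ 𝟙 (P? M) * ((n ∸ k) C j)
    above M = trans
      (∑-cong n (λ L → solve 3 (λ a b c → a :* (b :* c) := c :* (b :* a)) refl
         (𝟙 (♯ L ≟ j + k)) (𝟙 (M ⊑? L)) (𝟙 (P? M))))
      (trans (∑-distribˡ-* n (𝟙 (P? M)) _)
             (𝟙-guard (P? M) (λ p → ∑-above′ M j (P⇒♯ p))))

-- Both sides count the pairs `M ⊑ L` with `♯ M = k` and `♯ L = j + k`, once from `L` and once from
-- `M`.
nC-trinomial : ∀ n k j → (n C (j + k)) * ((j + k) C k) ≡ (n C k) * ((n ∸ k) C j)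
nC-trinomial n k j = begin
  (n C (j + k)) * ((j + k) C k)
    ≡⟨ cong (_* ((j + k) C k)) (∑-size n (j + k)) ⟨
  ∑ n (λ L → 𝟙 (♯ L ≟ j + k)) * ((j + k) C k)
    ≡⟨ ∑-distribʳ-* n ((j + k) C k) (λ L → 𝟙 (♯ L ≟ j + k)) ⟨
  ∑ n (λ L → 𝟙 (♯ L ≟ j + k) * ((j + k) C k))
    ≡⟨ ∑-cong n (λ L → 𝟙-guard (♯ L ≟ j + k) (λ eq →
         trans (cong (_C k) (sym eq)) (sym (∑-below L k)))) ⟩
  ∑ n (λ L → 𝟙 (♯ L ≟ j + k) * ∑ n (λ M → 𝟙 (M ⊑? L) * 𝟙 (♯ M ≟ k)))
    ≡⟨ ∑-pairs {n} {j = j} (λ M → ♯ M ≟ k) id ⟩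
  ∑ n (λ M → 𝟙 (♯ M ≟ k)) * ((n ∸ k) C j)
    ≡⟨ cong (_* ((n ∸ k) C j)) (∑-size n k) ⟩
  (n C k) * ((n ∸ k) C j) ∎
  where open ≡-Reasoning

nC>0 : ∀ {n k} → k ≤ n → 0 ℕ.< n C k
nC>0 {n}     {zero}  _         = ≤-reflexive (sym (nC0≡1 n))
nC>0 {suc n} {suc k} (s≤s k≤n) = ≤-trans (nC>0 k≤n)
  (≤-trans (m≤m+n _ _) (≤-reflexive (nCk+nC[k+1]≡[n+1]C[k+1] n k)))

-- Each set of size `j + k` lies in a pair with some `M` satisfying `P`, so `∑-pairs` bounds the
-- number of such sets. Multiplying by `(j + k) C k` and applying `nC-trinomial` produces the factor
-- `(n ∸ k) C j` on both sides; it is positive because `j + k ≤ n`, and cancels.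
supersaturation :
  ∀ {n k j} {P : Subset n → Set} (P? : Decidable P) (P⇒♯ : ∀ {M} → P M → ♯ M ≡ k) →
  (∀ L → ♯ L ≡ j + k → ∃[ M ] (M ⊑ L × P M)) → j + k ≤ n →
  n C k ≤ ∑ n (𝟙 ∘ P?) * ((j + k) C k)
supersaturation {n} {k} {j} P? P⇒♯ dense j+k≤n =
  *-cancelʳ-≤ _ _ ((n ∸ k) C j) {{>-nonZero (nC>0 j≤n∸k)}} (begin
    (n C k) * ((n ∸ k) C j)
      ≡⟨ nC-trinomial n k j ⟨
    (n C (j + k)) * D
      ≤⟨ *-monoˡ-≤ D large ⟩
    ∑ n (𝟙 ∘ P?) * ((n ∸ k) C j) * D
      ≡⟨ solve 3 (λ a b c → a :* b :* c := a :* c :* b) refl (∑ n (𝟙 ∘ P?)) ((n ∸ k) C j) D ⟩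
    ∑ n (𝟙 ∘ P?) * D * ((n ∸ k) C j) ∎)
  where
  open ≤-Reasoning
  open +-*-Solver
  D = (j + k) C k

  j≤n∸k : j ≤ n ∸ k
  j≤n∸k = ≤-trans (≤-reflexive (sym (m+n∸n≡m j k))) (∸-monoˡ-≤ k j+k≤n)

  contained : ∀ L → 𝟙 (♯ L ≟ j + k) ≤ 𝟙 (♯ L ≟ j + k) * ∑ n (λ M → 𝟙 (M ⊑? L) * 𝟙 (P? M))
  contained L = 𝟙≤𝟙* (♯ L ≟ j + k) witnessed
    where
    witnessed : ♯ L ≡ j + k → 1 ≤ ∑ n (λ M → 𝟙 (M ⊑? L) * 𝟙 (P? M))
    witnessed eq with dense L eq
    ... | M , M⊑L , p = ≤-trans
      (≤-reflexive (sym (cong₂ _*_ (𝟙-yes (M ⊑? L) M⊑L) (𝟙-yes (P? M) p))))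
      (term≤∑ n (λ M → 𝟙 (M ⊑? L) * 𝟙 (P? M)) M)

  large : n C (j + k) ≤ ∑ n (𝟙 ∘ P?) * ((n ∸ k) C j)
  large = begin
    n C (j + k)                    ≡⟨ ∑-size n (j + k) ⟨
    ∑ n (λ L → 𝟙 (♯ L ≟ j + k))    ≤⟨ ∑-mono n contained ⟩
    ∑ n (λ L → 𝟙 (♯ L ≟ j + k) * ∑ n (λ M → 𝟙 (M ⊑? L) * 𝟙 (P? M)))
                                   ≡⟨ ∑-pairs {j = j} P? P⇒♯ ⟩
    ∑ n (𝟙 ∘ P?) * ((n ∸ k) C j)   ∎

-- Sizes and shapes of trees

∣t∣>0 : ∀ t → 0 ℕ.< ∣ t ∣
∣t∣>0 leaf           = s≤s z≤n
∣t∣>0 (node (t ∷ _)) = m≤n⇒m≤n+o _ (∣t∣>0 t)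

weight : List Tree → ℕ
weight ts = sum (map ∣_∣ ts)

weight-toList : ∀ {n} (ts : Vec Tree n) → weight (toList ts) ≡ ∣ ts ∣*
weight-toList []       = refl
weight-toList (t ∷ ts) = cong (∣ t ∣ +_) (weight-toList ts)

mutual
  ≅⇒∣∣≡ : ∀ {t u} → t ≅ u → ∣ t ∣ ≡ ∣ u ∣
  ≅⇒∣∣≡ leaf                       = refl
  ≅⇒∣∣≡ (node {ts = ts} {us = us} p) =
    trans (sym (weight-toList ts)) (trans (↭⇒weight≡ p) (weight-toList us))

  ↭⇒weight≡ : ∀ {ts us} → Permutation _≅_ ts us → weight ts ≡ weight us
  ↭⇒weight≡ (Perm.refl es)   = ≅*⇒weight≡ es
  ↭⇒weight≡ (prep e p)       = cong₂ _+_ (≅⇒∣∣≡ e) (↭⇒weight≡ p)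
  ↭⇒weight≡ (swap {xs} {ys} {x} {y} {x′} {y′} e f p) = begin
    ∣ x ∣ + (∣ y ∣ + weight xs)
      ≡⟨ cong₂ _+_ (≅⇒∣∣≡ e) (cong₂ _+_ (≅⇒∣∣≡ f) (↭⇒weight≡ p)) ⟩
    ∣ x′ ∣ + (∣ y′ ∣ + weight ys)
      ≡⟨ solve 3 (λ a b c → a :+ (b :+ c) := b :+ (a :+ c)) refl
           ∣ x′ ∣ ∣ y′ ∣ (weight ys) ⟩
    ∣ y′ ∣ + (∣ x′ ∣ + weight ys)   ∎
    where open ≡-Reasoning; open +-*-Solver
  ↭⇒weight≡ (Perm.trans p q) = trans (↭⇒weight≡ p) (↭⇒weight≡ q)

  ≅*⇒weight≡ : ∀ {ts us} → PW.Pointwise _≅_ ts us → weight ts ≡ weight us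
  ≅*⇒weight≡ PW.[]       = refl
  ≅*⇒weight≡ (e PW.∷ es) = cong₂ _+_ (≅⇒∣∣≡ e) (≅*⇒weight≡ es)

-- Comparing the children as lists avoids transporting vectors along an equation between their
-- lengths.
node-≅ : ∀ {k l} {ts : Vec Tree (2 + k)} {us : Vec Tree (2 + l)} →
         toList ts ≡ toList us → node ts ≅ node us
node-≅ {ts = ts} eq =
  node (Perm.refl (subst (PW.Pointwise _≅_ (toList ts)) eq (≅*-refl ts)))

star : ℕ → Tree
star m = node (Vec.replicate (2 + m) leaf)

∣star∣ : ∀ m → ∣ star m ∣ ≡ 2 + m
∣star∣ m = leaves (2 + m)
  where
  leaves : ∀ k → ∣ Vec.replicate k leaf ∣* ≡ k
  leaves zero    = refl
  leaves (suc k) = cong suc (leaves k)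

cat : ℕ → Tree
cat zero    = leaf
cat (suc d) = node (leaf ∷ cat d ∷ [])

∣cat∣ : ∀ d → ∣ cat d ∣ ≡ suc d
∣cat∣ zero    = refl
∣cat∣ (suc d) = cong suc (trans (+-identityʳ _) (∣cat∣ d))

leafVertex : ∀ t → ∃[ v ] IsLeaf {t} v
leafVertex leaf             = root , refl
leafVertex (node (t ∷ ts)) with leafVertex t
... | v , v-leaf = below zero v , v-leaf

rootDegree≡0⇒leaf : ∀ {t} → rootDegree t ≡ 0 → t ≡ leaf
rootDegree≡0⇒leaf {leaf} _ = refl

≡replicate : ∀ {A : Set} {n} {x : A} (xs : Vec A n) →
             (∀ i → lookup xs i ≡ x) → xs ≡ Vec.replicate n x
≡replicate []       _  = refl
≡replicate (_ ∷ xs) eq = cong₂ _∷_ (eq zero) (≡replicate xs (eq ∘ suc))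

Star⇒star : ∀ {S} → Star S → ∃[ m ] S ≡ star m
-- The only leaf of the single-vertex tree is its root, which is no child of the root; this tree is
-- a caterpillar but not a `Star`.
Star⇒star {leaf} S-star with S-star root refl
... | ()
Star⇒star {node {k} ts} S-star = k , cong node (≡replicate ts λ i →
  rootDegree≡0⇒leaf (leaf-child i (leafVertex (lookup ts i))))
  where
  leaf-child : ∀ i → ∃[ v ] IsLeaf {lookup ts i} v → rootDegree (lookup ts i) ≡ 0
  leaf-child i (v , v-leaf) with S-star (below i v) v-leaf
  ... | child .i = v-leaf

Vertex-leaf : ∀ {t} → t ≡ leaf → (v : Vertex t) → v ≡ root
Vertex-leaf refl root = refl

star-Star : ∀ m → Star (star m)
star-Star m (below i v) _
  rewrite Vertex-leaf (lookup-replicate i leaf) v = child i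

leaf-resp-≅ : ∀ {t u} → t ≅ u → t ≡ leaf → u ≡ leaf
leaf-resp-≅ leaf _ = refl

All⇒≡replicate : ∀ {A : Set} {n} {x : A} (xs : Vec A n) →
                 All (_≡ x) (toList xs) → xs ≡ Vec.replicate n x
All⇒≡replicate []       []         = refl
All⇒≡replicate (_ ∷ xs) (eq ∷ eqs) = cong₂ _∷_ eq (All⇒≡replicate xs eqs)

replicate-All : ∀ {A : Set} n (x : A) → All (_≡ x) (toList (Vec.replicate n x))
replicate-All zero    x = []
replicate-All (suc n) x = refl ∷ replicate-All n x

-- An isomorphism permutes the children of the root and takes leaves to leaves, so all children of
-- `S` are leaves.
≅star⇒Star : ∀ {S m} → S ≅ star m → Star S
≅star⇒Star {m = m} (node {k} {ts = ts} p) = subst Star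
  (cong node (sym (All⇒≡replicate ts
    (Permₚ.All-resp-↭ ≅-setoid leaf-resp-≅ (↭-sym p) (replicate-All (2 + m) leaf)))))
  (star-Star k)

leaf-Caterpillar : BinaryCaterpillar leaf
leaf-Caterpillar = (λ { root → z≤n }) , root , λ { root _ → root }

below-zero-Caterpillar : ∀ {t} → BinaryCaterpillar t →
  BinaryCaterpillar (node (t ∷ leaf ∷ []))
below-zero-Caterpillar (t-binary , w , onPath) =
  (λ { root → ≤-refl
     ; (below zero v) → t-binary v
     ; (below (suc zero) root) → z≤n }) ,
  below zero w ,
  λ { root _ → root
    ; (below zero v) v-inner → below (onPath v v-inner)
    ; (below (suc zero) root) v-inner → contradiction refl v-inner }

below-one-Caterpillar : ∀ {t} → BinaryCaterpillar t →
  BinaryCaterpillar (node (leaf ∷ t ∷ []))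
below-one-Caterpillar (t-binary , w , onPath) =
  (λ { root → ≤-refl
     ; (below zero root) → z≤n
     ; (below (suc zero) v) → t-binary v }) ,
  below (suc zero) w ,
  λ { root _ → root
    ; (below zero root) v-inner → contradiction refl v-inner
    ; (below (suc zero) v) v-inner → below (onPath v v-inner) }

↭-[-]⁻ : ∀ {t u} → Permutation _≅_ (t ∷ []) (u ∷ []) → t ≅ u
↭-[-]⁻ p with Permₚ.∈-resp-↭ ≅-setoid p (here ≅-refl)
... | here t≅u = t≅u

-- The leaf child of `cat (suc d)` corresponds to one of the two children of `S`. Cancelling this
-- pair leaves an isomorphism of the other child with `cat d`.
≅cat⇒Caterpillar : ∀ d {S} → S ≅ cat d → BinaryCaterpillar S
≅cat⇒Caterpillar zero    leaf = leaf-Caterpillar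
≅cat⇒Caterpillar (suc d) (node {zero} {ts = t ∷ u ∷ []} p)
  with Permₚ.∈-resp-↭ ≅-setoid (↭-sym p) (here ≅-refl)
... | here leaf = below-one-Caterpillar
  (≅cat⇒Caterpillar d (↭-[-]⁻ (Permₚ.drop-∷ ≅-setoid p)))
... | there (here leaf) = below-zero-Caterpillar
  (≅cat⇒Caterpillar d (↭-[-]⁻ (Permₚ.drop-∷ ≅-setoid
    (Perm.trans (swap ≅-refl ≅-refl (Perm.refl PW.[])) p))))
≅cat⇒Caterpillar (suc d) (node {suc k} {ts = _ ∷ _ ∷ _ ∷ _} p)
  with Permₚ.xs↭ys⇒|xs|≡|ys| ≅-setoid p
... | ()

node-cat : ∀ {d t u} → t ≡ leaf → u ≅ cat d → node (t ∷ u ∷ []) ≅ cat (suc d)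
node-cat refl u≅ = node (prep leaf (prep u≅ (Perm.refl PW.[])))

node-cat′ : ∀ {d t u} → t ≅ cat d → u ≡ leaf → node (t ∷ u ∷ []) ≅ cat (suc d)
node-cat′ t≅ refl = node (swap t≅ leaf (Perm.refl PW.[]))

≼-below⁻ : ∀ {k} {ts : Vec Tree (2 + k)} {i} {v w : Vertex (lookup ts i)} →
           below {ts = ts} i v ≼ below i w → v ≼ w
≼-below⁻ (below p) = p

¬inner⇒leaf : ∀ {t} → ¬ ¬ (rootDegree t ≡ 0) → t ≡ leaf
¬inner⇒leaf {leaf}   _ = refl
¬inner⇒leaf {node _} h = contradiction (λ ()) h

-- Follow the path to `w`: a sibling off the path is a leaf, since an inner vertex there would have
-- to lie above `w`. When the path ends at an inner vertex, both of its children are leaves.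
Caterpillar⇒≅cat : ∀ {S} → BinaryCaterpillar S → ∃[ d ] S ≅ cat d
Caterpillar⇒≅cat (S-binary , w , onPath) = descend w S-binary onPath
  where
  descend : ∀ {t} (w : Vertex t) → Binary t →
            ((v : Vertex t) → ¬ IsLeaf v → v ≼ w) → ∃[ d ] t ≅ cat d
  descend {leaf} root _ _ = 0 , leaf
  descend {node {suc k} _} _ t-binary _ with t-binary root
  ... | s≤s (s≤s ())
  descend {node {zero} (t ∷ u ∷ [])} root _ onPath = 1 , node-cat
    (¬inner⇒leaf λ h → case onPath (below zero root) h of λ ())
    (subst (_≅ leaf)
      (sym (¬inner⇒leaf λ h → case onPath (below (suc zero) root) h of λ ())) leaf)
  descend {node {zero} (t ∷ u ∷ [])} (below zero w) t-binary onPath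
    with descend w (λ v → t-binary (below zero v))
                   (λ v h → ≼-below⁻ (onPath (below zero v) h))
  ... | d , t≅ = suc d ,
    node-cat′ t≅ (¬inner⇒leaf λ h → case onPath (below (suc zero) root) h of λ ())
  descend {node {zero} (t ∷ u ∷ [])} (below (suc zero) w) t-binary onPath
    with descend w (λ v → t-binary (below (suc zero) v))
                   (λ v h → ≼-below⁻ (onPath (below (suc zero) v) h))
  ... | d , u≅ = suc d ,
    node-cat (¬inner⇒leaf λ h → case onPath (below zero root) h of λ ()) u≅

-- Induced trees

♯-++ : ∀ {m n} (L : Subset m) (M : Subset n) → ♯ (L ++ M) ≡ ♯ L + ♯ M
♯-++ []            M = refl
♯-++ (outside ∷ L) M = ♯-++ L M
♯-++ (inside  ∷ L) M = cong suc (♯-++ L M)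

-- `inducedForest` cuts its subset with `take` and `drop`, which recover the two parts of a
-- concatenation.
inducedForest-++ : ∀ {n} t (ts : Vec Tree n) L M →
                   inducedForest (t ∷ ts) (L ++ M) ≡
                   List.fromMaybe (induced t L) List.++ inducedForest ts M
inducedForest-++ t ts L M
  with ++-injective _ L (take++drop≡id ∣ t ∣ (L ++ M))
... | take≡ , drop≡ =
  cong₂ (λ L M → List.fromMaybe (induced t L) List.++ inducedForest ts M) take≡ drop≡

size : Maybe Tree → ℕ
size = maybe′ ∣_∣ 0

size-join : ∀ ts → size (join ts) ≡ weight ts
size-join []           = refl
size-join (t ∷ [])     = sym (+-identityʳ ∣ t ∣)
size-join (t ∷ u ∷ ts) = trans
  (sym (weight-toList (t ∷ u ∷ fromList ts)))
  (cong (λ us → weight (t ∷ u ∷ us)) (toList∘fromList ts))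

weight-fromMaybe-++ : ∀ mt ts → weight (List.fromMaybe mt List.++ ts) ≡ size mt + weight ts
weight-fromMaybe-++ nothing  ts = refl
weight-fromMaybe-++ (just t) ts = refl

mutual
  -- Removing empty branches and suppressing vertices of outdegree 1 loses no selected leaf.
  size-induced : ∀ t L → size (induced t L) ≡ ♯ L
  size-induced leaf      (inside  ∷ []) = refl
  size-induced leaf      (outside ∷ []) = refl
  size-induced (node ts) L = trans (size-join (inducedForest ts L)) (weight-inducedForest ts L)

  weight-inducedForest : ∀ {n} (ts : Vec Tree n) L → weight (inducedForest ts L) ≡ ♯ L
  weight-inducedForest []       [] = refl
  weight-inducedForest (t ∷ ts) L′ with Vec.splitAt ∣ t ∣ L′
  ... | L , M , refl = begin
    weight (List.fromMaybe (induced t L) List.++ inducedForest ts M)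
      ≡⟨ weight-fromMaybe-++ (induced t L) _ ⟩
    size (induced t L) + weight (inducedForest ts M)
      ≡⟨ cong₂ _+_ (size-induced t L) (weight-inducedForest ts M) ⟩
    ♯ L + ♯ M
      ≡⟨ ♯-++ L M ⟨
    ♯ (L ++ M) ∎
    where open ≡-Reasoning

Induces⇒♯ : ∀ {t L s} → Induces t L s → ♯ L ≡ ∣ s ∣
Induces⇒♯ {t} {L} p with induced t L | size-induced t L
Induces⇒♯ (Maybe.just u≅s) | just u | eq = trans (sym eq) (≅⇒∣∣≡ u≅s)

Induces-just : ∀ t L {u s} → induced t L ≡ just u → u ≅ s → Induces t L s
Induces-just _ _ {s = s} eq u≅s = subst (Maybe.Any (_≅ s)) (sym eq) (Maybe.just u≅s)

Induces-just⁻ : ∀ t L {u s} → induced t L ≡ just u → Induces t L s → u ≅ s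
Induces-just⁻ _ _ {s = s} eq p with subst (Maybe.Any (_≅ s)) eq p
... | Maybe.just u≅s = u≅s

node-leaves : ∀ m → node (leaf ∷ leaf ∷ fromList (List.replicate m leaf)) ≅ star m
node-leaves m = node-≅ (cong (λ ts → leaf ∷ leaf ∷ ts)
  (trans (toList∘fromList (List.replicate m leaf)) (sym (toList-replicate m leaf))))

induced-leaves : ∀ n (L : Subset ∣ Vec.replicate n leaf ∣*) →
                 inducedForest (Vec.replicate n leaf) L ≡ List.replicate (♯ L) leaf
induced-leaves zero    []            = refl
induced-leaves (suc n) (inside  ∷ L) = cong (leaf ∷_) (induced-leaves n L)
induced-leaves (suc n) (outside ∷ L) = induced-leaves n L

star-Induces : ∀ n m (L : Subset ∣ star n ∣) → ♯ L ≡ 2 + m → Induces (star n) L (star m)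
star-Induces n m L eq = Induces-just (star n) L
  (cong join (trans (induced-leaves (2 + n) L) (cong (λ k → List.replicate k leaf) eq)))
  (node-leaves m)

-- Indexed by the number of leaves, one more than the index of `cat`, so that the empty set of
-- leaves is covered.
catWith : ℕ → Maybe Tree
catWith zero    = nothing
catWith (suc d) = just (cat d)

-- A selected leaf at the root adds one level to whatever caterpillar is induced below it; if it is
-- not selected, or nothing below it is, the root is suppressed or removed.
induced-cat : ∀ d (L : Subset ∣ cat d ∣) → induced (cat d) L ≡ catWith (♯ L)
induced-cat zero    (inside  ∷ []) = refl
induced-cat zero    (outside ∷ []) = refl
induced-cat (suc d) (b ∷ L′) with Vec.splitAt ∣ cat d ∣ L′
induced-cat (suc d) (b ∷ L′) | L , [] , refl = begin
  join (List.fromMaybe (induced leaf (b ∷ [])) List.++ List.fromMaybe (induced (cat d) L) List.++ [])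
    ≡⟨ cong (λ t → join (List.fromMaybe (induced leaf (b ∷ [])) List.++
                         List.fromMaybe t List.++ [])) (induced-cat d L) ⟩
  join (List.fromMaybe (induced leaf (b ∷ [])) List.++ List.fromMaybe (catWith (♯ L)) List.++ [])
    ≡⟨ add-leaf b (♯ L) ⟩
  catWith (♯ (b ∷ []) + ♯ L)
    ≡⟨ cong catWith (♯-∷ b) ⟩
  catWith (♯ (b ∷ (L ++ []))) ∎
  where
  open ≡-Reasoning
  add-leaf : ∀ b k → join (List.fromMaybe (induced leaf (b ∷ [])) List.++
                           List.fromMaybe (catWith k) List.++ [])
                     ≡ catWith (♯ (b ∷ []) + k)
  add-leaf true  zero    = refl
  add-leaf true  (suc k) = refl
  add-leaf false zero    = refl
  add-leaf false (suc k) = refl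

  ♯-∷ : ∀ b → ♯ (b ∷ []) + ♯ L ≡ ♯ (b ∷ (L ++ []))
  ♯-∷ true  = cong suc (sym (trans (♯-++ L []) (+-identityʳ _)))
  ♯-∷ false = sym (trans (♯-++ L []) (+-identityʳ _))

cat-Induces : ∀ d e (L : Subset ∣ cat d ∣) → ♯ L ≡ suc e → Induces (cat d) L (cat e)
cat-Induces d e L eq = Induces-just (cat d) L (trans (induced-cat d L) (cong catWith eq)) ≅-refl

-- A Ramsey theorem for leaf sets

-- Equality with `mt` instead of isomorphism lets choices made in different branches be combined by
-- computation.
record InducesBelow (t : Tree) (L : Subset ∣ t ∣) (mt : Maybe Tree) : Set where
  constructor below
  field
    chosen  : Subset ∣ t ∣
    chosen⊑ : chosen ⊑ L
    induces : induced t chosen ≡ mt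

record InducesBelow* {n} (ts : Vec Tree n) (L : Subset ∣ ts ∣*) (us : List Tree) : Set where
  constructor below
  field
    chosen  : Subset ∣ ts ∣*
    chosen⊑ : chosen ⊑ L
    induces : inducedForest ts chosen ≡ us

infixr 5 _∷ᵢ_

_∷ᵢ_ : ∀ {n t} {ts : Vec Tree n} {L M mt us} →
       InducesBelow t L mt → InducesBelow* ts M us →
       InducesBelow* (t ∷ ts) (L ++ M) (List.fromMaybe mt List.++ us)
_∷ᵢ_ {t = t} {ts} (below L′ L′⊑L refl) (below M′ M′⊑M refl) =
  below (L′ ++ M′) (Pointwise.++⁺ L′⊑L M′⊑M) (inducedForest-++ t ts L′ M′)

join-below : ∀ {k} {ts : Vec Tree (2 + k)} {L us} →
             InducesBelow* ts L us → InducesBelow (node ts) L (join us)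
join-below (below M M⊑L refl) = below M M⊑L refl

mutual
  none : ∀ t L → InducesBelow t L nothing
  none leaf      (b ∷ []) = below (outside ∷ []) (Boolₚ.≤-minimum b ∷ []) refl
  none (node ts) L        = join-below (none* ts L)

  none* : ∀ {n} (ts : Vec Tree n) L → InducesBelow* ts L []
  none* []       [] = below [] [] refl
  none* (t ∷ ts) L′ with Vec.splitAt ∣ t ∣ L′
  ... | L , M , refl = none t L ∷ᵢ none* ts M

n≡0⊎n>0 : ∀ n → n ≡ 0 ⊎ 0 ℕ.< n
n≡0⊎n>0 zero    = inj₁ refl
n≡0⊎n>0 (suc n) = inj₂ (s≤s z≤n)

♯-outside : ∀ {m n} (L : Subset m) (M : Subset n) → ♯ L ≡ 0 →
            ∀ {a} → a ℕ.< ♯ (L ++ M) → a ℕ.< ♯ M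
♯-outside L M eq = subst (_ ℕ.<_) (trans (♯-++ L M) (cong (_+ ♯ M) eq))

mutual
  single : ∀ t L → 0 ℕ.< ♯ L → InducesBelow t L (just leaf)
  single leaf      (inside ∷ []) _   = below (inside ∷ []) (b≤b ∷ []) refl
  single (node ts) L             0<♯ = join-below (single* ts L 0<♯)

  single* : ∀ {n} (ts : Vec Tree n) L → 0 ℕ.< ♯ L → InducesBelow* ts L (leaf ∷ [])
  single* []       [] ()
  single* (t ∷ ts) L′ 0<♯ with Vec.splitAt ∣ t ∣ L′
  ... | L , M , refl with n≡0⊎n>0 (♯ L)
  ...   | inj₁ ♯L≡0 = none t L ∷ᵢ single* ts M (♯-outside L M ♯L≡0 0<♯)
  ...   | inj₂ 0<♯L = single t L 0<♯L ∷ᵢ none* ts M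

module Ramsey (m : ℕ) where

  -- By definition `bound (suc d)` is `bound d + m * bound d`: the share of one small branch plus
  -- that of `m` further ones.
  bound : ℕ → ℕ
  bound d = (1 + m) ^ d

  Homogeneous : ℕ → Tree → Set
  Homogeneous d u = u ≅ star m ⊎ u ≅ cat d

  ♯-rest : ∀ {p q} (L : Subset p) (M : Subset q) {a b} →
           ♯ L ≤ a → a + b ℕ.< ♯ (L ++ M) → b ℕ.< ♯ M
  ♯-rest L M {a} {b} ♯L≤a h = +-cancelˡ-< a b (♯ M)
    (<-≤-trans h (≤-trans (≤-reflexive (♯-++ L M)) (+-monoˡ-≤ (♯ M) ♯L≤a)))

  mutual
    -- The exponent drops only when a leaf outside of the branch is available to extend `cat d` to
    -- `cat (suc d)`; otherwise the recursion is on a smaller tree. A single leaf cannot hold more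
    -- than `bound (suc d)` selected leaves, as this bound is at least 1.
    homogeneous : ∀ d t L → bound d ℕ.< ♯ L →
                  ∃[ u ] (Homogeneous d u × InducesBelow t L (just u))
    homogeneous zero    t         L h = leaf , inj₂ leaf , single t L (≤-<-trans z≤n h)
    homogeneous (suc d) leaf      L h =
      contradiction (<-≤-trans h (∣p∣≤n L)) (≤⇒≯ (m^n>0 (1 + m) (suc d)))
    homogeneous (suc d) (node ts) L h with homogeneous* d ts L h
    ... | us , u , eq , hom , ind =
      u , hom , subst (InducesBelow (node ts) L) eq (join-below ind)

    homogeneous* : ∀ {n} d (ts : Vec Tree n) L → bound (suc d) ℕ.< ♯ L →
      ∃₂ λ us u → join us ≡ just u × Homogeneous (suc d) u × InducesBelow* ts L us
    homogeneous* d []       [] ()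
    homogeneous* d (t ∷ ts) L′ h with Vec.splitAt ∣ t ∣ L′
    ... | L , M , refl with n≡0⊎n>0 (♯ L) | n≡0⊎n>0 (♯ M)
    ...   | inj₁ ♯L≡0 | _ with homogeneous* d ts M (♯-outside L M ♯L≡0 h)
    ...     | us , u , eq , hom , ind = us , u , eq , hom , none t L ∷ᵢ ind
    -- All selected leaves lie in `t`, so `join` suppresses the root and the exponent stays the
    -- same.
    homogeneous* d (t ∷ ts) L′ h | L , M , refl | inj₂ 0<♯L | inj₁ ♯M≡0
      with homogeneous (suc d) t L (subst (_ ℕ.<_)
             (trans (♯-++ L M) (trans (cong (♯ L +_) ♯M≡0) (+-identityʳ _))) h)
    ... | u , hom , ind = u ∷ [] , u , refl , hom , ind ∷ᵢ none* ts M
    homogeneous* d (t ∷ ts) L′ h | L , M , refl | inj₂ 0<♯L | inj₂ 0<♯M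
      with bound d <? ♯ L
    ... | yes large with homogeneous d t L large
    ...   | u , inj₁ u≅star , ind = u ∷ [] , u , refl , inj₁ u≅star , ind ∷ᵢ none* ts M
    -- One selected leaf outside of `t` lengthens the caterpillar.
    ...   | u , inj₂ u≅cat  , ind =
      u ∷ leaf ∷ [] , _ , refl , inj₂ (node-cat′ u≅cat refl) , ind ∷ᵢ single* ts M 0<♯M
    -- The branch `t` uses up at most `bound d` selected leaves, so more than `m * bound d` remain.
    -- A leaf of `t` then completes either `suc m` leaves from other branches to a star, or a
    -- caterpillar in one of these branches to a longer one.
    homogeneous* d (t ∷ ts) L′ h | L , M , refl | inj₂ 0<♯L | inj₂ 0<♯M
      | no ¬large with spread d m ts M (♯-rest L M (≮⇒≥ ¬large) h)
    ...   | inj₁ ind =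
      leaf ∷ List.replicate (suc m) leaf , _ , refl ,
      inj₁ (node-leaves m) , single t L 0<♯L ∷ᵢ ind
    ...   | inj₂ (u , inj₁ u≅star , ind) = u ∷ [] , u , refl , inj₁ u≅star , none t L ∷ᵢ ind
    ...   | inj₂ (u , inj₂ u≅cat  , ind) =
      leaf ∷ u ∷ [] , _ , refl ,
      inj₂ (node-cat refl u≅cat) , single t L 0<♯L ∷ᵢ ind

    -- A branch with more than `bound d` selected leaves gives the second alternative. Any other
    -- nonempty branch contributes one leaf and costs at most `bound d`, so the selected leaves last
    -- for `suc j` branches.
    spread : ∀ {n} d j (ts : Vec Tree n) L → j * bound d ℕ.< ♯ L →
             InducesBelow* ts L (List.replicate (suc j) leaf)
             ⊎ ∃[ u ] (Homogeneous d u × InducesBelow* ts L (u ∷ []))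
    spread d j []       [] ()
    spread d j (t ∷ ts) L′ h with Vec.splitAt ∣ t ∣ L′
    ... | L , M , refl with n≡0⊎n>0 (♯ L)
    ...   | inj₁ ♯L≡0 =
      Sum.map (none t L ∷ᵢ_) (λ (u , hom , ind) → u , hom , none t L ∷ᵢ ind)
        (spread d j ts M (♯-outside L M ♯L≡0 h))
    spread d zero    (t ∷ ts) L′ h | L , M , refl | inj₂ 0<♯L =
      inj₁ (single t L 0<♯L ∷ᵢ none* ts M)
    spread d (suc j) (t ∷ ts) L′ h | L , M , refl | inj₂ 0<♯L with bound d <? ♯ L
    ... | yes large with homogeneous d t L large
    ...   | u , hom , ind = inj₂ (u , hom , ind ∷ᵢ none* ts M)
    spread d (suc j) (t ∷ ts) L′ h | L , M , refl | inj₂ 0<♯L | no ¬large =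
      Sum.map (single t L 0<♯L ∷ᵢ_) (λ (u , hom , ind) → u , hom , none t L ∷ᵢ ind)
        (spread d j ts M (♯-rest L M (≮⇒≥ ¬large) h))

-- Densities

∑-induces : ∀ s t → c s t ≡ ∑ ∣ t ∣ (𝟙 ∘ induces? t s)
∑-induces s t = length-filter-subsets ∣ t ∣ (induces? t s)

𝟙-split : {P Q : Set} (p : Dec P) (q : Dec Q) → (Q → P) →
          𝟙 p ≡ 𝟙 q + 𝟙 (p ×-dec ¬? q)
𝟙-split (yes _) (yes _) _   = refl
𝟙-split (yes _) (no _)  _   = refl
𝟙-split (no ¬p) (yes q) q⇒p = contradiction (q⇒p q) ¬p
𝟙-split (no _)  (no _)  _   = refl

Misses : (s t : Tree) → Subset ∣ t ∣ → Set
Misses s t L = ♯ L ≡ ∣ s ∣ × ¬ Induces t L s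

misses? : ∀ s t L → Dec (Misses s t L)
misses? s t L = (♯ L ≟ ∣ s ∣) ×-dec ¬? (induces? t s L)

-- Only sets of size `∣ s ∣` can induce `s`, so these sets split into the ones that induce `s` and
-- the ones that miss it.
c+misses : ∀ s t → c s t + ∑ ∣ t ∣ (𝟙 ∘ misses? s t) ≡ ∣ t ∣ C ∣ s ∣
c+misses s t = begin
  c s t + ∑ₜ (𝟙 ∘ misses? s t)
    ≡⟨ cong (_+ ∑ₜ (𝟙 ∘ misses? s t)) (∑-induces s t) ⟩
  ∑ₜ (𝟙 ∘ induces? t s) + ∑ₜ (𝟙 ∘ misses? s t)
    ≡⟨ ∑-distrib-+ (∣ t ∣) _ _ ⟨
  ∑ₜ (λ L → 𝟙 (induces? t s L) + 𝟙 (misses? s t L))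
    ≡⟨ ∑-cong (∣ t ∣) (λ L → 𝟙-split (♯ L ≟ ∣ s ∣) (induces? t s L) (Induces⇒♯ {t})) ⟨
  ∑ₜ (λ L → 𝟙 (♯ L ≟ ∣ s ∣))
    ≡⟨ ∑-size ∣ t ∣ ∣ s ∣ ⟩
  ∣ t ∣ C ∣ s ∣ ∎
  where
  open ≡-Reasoning
  ∑ₜ = ∑ ∣ t ∣

c≤C : ∀ s t → c s t ≤ ∣ t ∣ C ∣ s ∣
c≤C s t = m+n≤o⇒m≤o _ (≤-reflexive (c+misses s t))

c≡C : ∀ s t → (∀ L → ♯ L ≡ ∣ s ∣ → Induces t L s) → c s t ≡ ∣ t ∣ C ∣ s ∣
c≡C s t all = trans
  (sym (trans
    (cong (c s t +_) (∑-zero ∣ t ∣ (λ L →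
      𝟙-no (misses? s t L) (λ (eq , ¬ind) → ¬ind (all L eq)))))
    (+-identityʳ _)))
  (c+misses s t)

-- Comparison of rationals

-- `_/_` reduces fractions to lowest terms; the order is cross-multiplication only for unnormalised
-- rationals, hence the detour.
/-mono-≤ : ∀ a b c d → a * suc d ≤ b * suc c → (ℤ.+ a / suc c) ℚ.≤ (ℤ.+ b / suc d)
/-mono-≤ a b c d h = ℚₚ.toℚᵘ-cancel-≤ (begin
  ℚ.toℚᵘ (ℤ.+ a / suc c)  ≃⟨ ℚₚ.toℚᵘ-fromℚᵘ (mkℚᵘ (ℤ.+ a) c) ⟩
  mkℚᵘ (ℤ.+ a) c
    ≤⟨ *≤* (subst₂ ℤ._≤_ (ℤₚ.pos-* a (suc d)) (ℤₚ.pos-* b (suc c)) (ℤ.+≤+ h)) ⟩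
  mkℚᵘ (ℤ.+ b) d          ≃⟨ ℚₚ.toℚᵘ-fromℚᵘ (mkℚᵘ (ℤ.+ b) d) ⟨
  ℚ.toℚᵘ (ℤ.+ b / suc d)  ∎)
  where open ℚᵘₚ.≤-Reasoning

/-mono-< : ∀ a b c d → a * suc d ℕ.< b * suc c → (ℤ.+ a / suc c) ℚ.< (ℤ.+ b / suc d)
/-mono-< a b c d h = ℚₚ.toℚᵘ-cancel-< (begin-strict
  ℚ.toℚᵘ (ℤ.+ a / suc c)  ≃⟨ ℚₚ.toℚᵘ-fromℚᵘ (mkℚᵘ (ℤ.+ a) c) ⟩
  mkℚᵘ (ℤ.+ a) c
    <⟨ *<* (subst₂ ℤ._<_ (ℤₚ.pos-* a (suc d)) (ℤₚ.pos-* b (suc c)) (ℤ.+<+ h)) ⟩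
  mkℚᵘ (ℤ.+ b) d          ≃⟨ ℚₚ.toℚᵘ-fromℚᵘ (mkℚᵘ (ℤ.+ b) d) ⟨
  ℚ.toℚᵘ (ℤ.+ b / suc d)  ∎)
  where open ℚᵘₚ.≤-Reasoning

γ-≤ : ∀ s t a d → c s t * suc d ≤ a * (∣ t ∣ C ∣ s ∣) → γ s t ℚ.≤ (ℤ.+ a / suc d)
γ-≤ s t a d h with ∣ t ∣ C ∣ s ∣
-- Here `γ s t` is 0 by convention.
... | zero  = ℚₚ.nonNegative⁻¹ _ {{ℚₚ.normalize-nonNeg a (suc d)}}
... | suc e = /-mono-≤ (c s t) a e d h

γ-≥ : ∀ s t a d → 0 ℕ.< ∣ t ∣ C ∣ s ∣ → a * (∣ t ∣ C ∣ s ∣) ≤ c s t * suc d →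
      (ℤ.+ a / suc d) ℚ.≤ γ s t
γ-≥ s t a d pos h with ∣ t ∣ C ∣ s ∣
... | suc e = /-mono-≤ a (c s t) d e h

-- Maxima and limits superior

-- For positive `n` the maximum is attained by a tree, so its default value 0 needs no separate
-- bound.
maxγ-≤ : ∀ s {n r} → 0 ℕ.< n → (∀ t → ∣ t ∣ ≡ n → γ s t ℚ.≤ r) → maxγ s n ℚ.≤ r
maxγ-≤ s {suc n} _ γ≤ with maxγ-attained s n
... | t , ∣t∣≡ , eq = subst (ℚ._≤ _) eq (γ≤ t ∣t∣≡)

limsup-const : ∀ {a p N} → (∀ n → N ≤ n → a n ≡ p) → limsup a ≈ fromℚ p
limsup-const {a} {p} {N} a≡p =
  (λ q → mk⇔
    (λ (r , q<r , often) → case often N of λ (n , N≤n , r≤a) →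
      ℚₚ.<-≤-trans q<r (subst (r ℚ.≤_) (a≡p n N≤n) r≤a))
    (λ q<p → p , q<p , λ M →
      -- The index `M + N` is beyond both the requested `M` and the threshold `N`.
      M + N , m≤m+n M N , ℚₚ.≤-reflexive (sym (a≡p (M + N) (m≤n+m N M))))) ,
  (λ q → mk⇔
    (λ (r , r<q , M , a≤r) →
      ℚₚ.≤-<-trans
        (subst (ℚ._≤ r) (a≡p (M + N) (m≤n+m N M)) (a≤r (M + N) (m≤m+n M N))) r<q)
    (λ p<q → p , p<q , N , λ n N≤n → ℚₚ.≤-reflexive (a≡p n N≤n)))

-- `Upper` asks for an eventual bound strictly below `q`, so `q` is taken strictly between `r` and
-- `p`.
limsup-< : ∀ {a p r N} → r ℚ.< p → (∀ n → N ≤ n → a n ℚ.≤ r) → limsup a < fromℚ p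
limsup-< {r = r} {N} r<p a≤r with ℚₚ.<-dense r<p
... | q , r<q , q<p = q , (r , r<q , N , a≤r) , q<p

-- Stars and binary caterpillars

-- One such tree for every `n` makes `maxγ s n` equal to 1 from `∣ s ∣` on, not merely in the limit.
Unavoidable : Tree → Set
Unavoidable s = ∀ n → ∣ s ∣ ≤ n →
  ∃[ t ] (∣ t ∣ ≡ n × (∀ L → ♯ L ≡ ∣ s ∣ → Induces t L s))

Unavoidable⇒J≈1 : ∀ s → Unavoidable s → J s ≈ fromℚ 1ℚ
Unavoidable⇒J≈1 s unavoidable = limsup-const {N = ∣ s ∣} maxγ≡1
  where
  maxγ≡1 : ∀ n → ∣ s ∣ ≤ n → maxγ s n ≡ 1ℚ
  maxγ≡1 n ∣s∣≤n with unavoidable n ∣s∣≤n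
  ... | t , refl , all = ℚₚ.≤-antisym
    (maxγ-≤ s (∣t∣>0 t) (λ u _ → γ-≤ s u 1 0
      (subst₂ _≤_ (sym (*-identityʳ _)) (sym (*-identityˡ _)) (c≤C s u))))
    (ℚₚ.≤-trans
      (γ-≥ s t 1 0 (nC>0 ∣s∣≤n)
        (≤-reflexive (trans (*-identityˡ _) (trans (sym (c≡C s t all)) (sym (*-identityʳ _))))))
      (γ≤maxγ s t))

Induces-resp-≅ : ∀ {t L s s′} → s ≅ s′ → Induces t L s → Induces t L s′
Induces-resp-≅ s≅s′ = Maybe.map (λ u≅s → ≅-trans u≅s s≅s′)

star-unavoidable : ∀ m → Unavoidable (star m)
star-unavoidable m n ∣s∣≤n with subst (_≤ n) (∣star∣ m) ∣s∣≤n
... | s≤s (s≤s {n = k} _) = star k , ∣star∣ k , λ L ♯L≡ →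
  star-Induces k m L (trans ♯L≡ (∣star∣ m))

-- Stated up to isomorphism, because a binary caterpillar may have its leaf children on either side.
≅cat-unavoidable : ∀ {s} d → s ≅ cat d → Unavoidable s
≅cat-unavoidable {s} d s≅cat n ∣s∣≤n with <-≤-trans (∣t∣>0 s) ∣s∣≤n
... | s≤s {n = e} _ = cat e , ∣cat∣ e , λ L ♯L≡ → Induces-resp-≅ {cat e} (≅-sym s≅cat)
  (cat-Induces e d L (trans ♯L≡ (trans (≅⇒∣∣≡ s≅cat) (∣cat∣ d))))

2≤∣node∣ : ∀ {k} (ts : Vec Tree (2 + k)) → 2 ≤ ∣ node ts ∣
2≤∣node∣ (t ∷ u ∷ ts) = +-mono-≤ (∣t∣>0 t) (m≤n⇒m≤n+o _ (∣t∣>0 u))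

-- All other trees

module _ {s} (¬star : ¬ Star s) (¬cat : ¬ BinaryCaterpillar s)
         {m} (∣s∣≡ : ∣ s ∣ ≡ 2 + m) where

  open Ramsey m

  -- With exponent `suc m` the star and the caterpillar both have `2 + m` leaves, the size of `s`,
  -- and `s` is isomorphic to neither.
  missed : ∀ t L → ♯ L ≡ bound (suc m) + ∣ s ∣ → ∃[ M ] (M ⊑ L × Misses s t M)
  missed t L ♯L≡ with homogeneous (suc m) t L
    (subst (bound (suc m) ℕ.<_) (sym ♯L≡) (m<m+n _ (∣t∣>0 s)))
  ... | u , hom , below M M⊑L eq = M , M⊑L ,
    trans (trans (sym (size-induced t M)) (cong size eq)) (trans (∣hom∣ hom) (sym ∣s∣≡)) ,
    λ ind → ≇s hom (Induces-just⁻ t M eq ind)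
    where
    ∣hom∣ : ∀ {u} → Homogeneous (suc m) u → ∣ u ∣ ≡ 2 + m
    ∣hom∣ (inj₁ u≅star) = trans (≅⇒∣∣≡ u≅star) (∣star∣ m)
    ∣hom∣ (inj₂ u≅cat)  = trans (≅⇒∣∣≡ u≅cat) (∣cat∣ (suc m))

    ≇s : ∀ {u} → Homogeneous (suc m) u → ¬ (u ≅ s)
    ≇s (inj₁ u≅star) u≅s = ¬star (≅star⇒Star (≅-trans (≅-sym u≅s) u≅star))
    ≇s (inj₂ u≅cat)  u≅s = ¬cat (≅cat⇒Caterpillar (suc m) (≅-trans (≅-sym u≅s) u≅cat))

  -- By `supersaturation`, `missing * suc d` is at least `total`; subtracting this from
  -- `suc d * total` leaves at most `d * total` for `c s t * suc d`.
  c-bound : ∀ t {d} → (bound (suc m) + ∣ s ∣) C ∣ s ∣ ≡ suc d → bound (suc m) + ∣ s ∣ ≤ ∣ t ∣ →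
            c s t * suc d ≤ d * (∣ t ∣ C ∣ s ∣)
  c-bound t {d} D≡ large = +-cancelˡ-≤ total _ _ (begin
    total + c s t * suc d
      ≤⟨ +-monoˡ-≤ _ (supersaturation {j = bound (suc m)} (misses? s t) proj₁ (missed t) large) ⟩
    missing * ((bound (suc m) + ∣ s ∣) C ∣ s ∣) + c s t * suc d
      ≡⟨ cong (λ D → missing * D + c s t * suc d) D≡ ⟩
    missing * suc d + c s t * suc d
      ≡⟨ solve 3 (λ a b d → a :* d :+ b :* d := d :* (b :+ a)) refl missing (c s t) (suc d) ⟩
    suc d * (c s t + missing)
      ≡⟨ cong (suc d *_) (c+misses s t) ⟩
    total + d * total ∎)
    where
    open ≤-Reasoning
    open +-*-Solver
    total   = ∣ t ∣ C ∣ s ∣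
    missing = ∑ ∣ t ∣ (𝟙 ∘ misses? s t)

  J<1 : J s < fromℚ 1ℚ
  -- Positivity excludes a binomial coefficient 0. Writing it as `suc d` gives the bound `d / suc d`
  -- for all large `n`.
  J<1 with (bound (suc m) + ∣ s ∣) C ∣ s ∣ in D≡
         | nC>0 {bound (suc m) + ∣ s ∣} {∣ s ∣} (m≤n+m _ _)
  ... | suc d | _ = limsup-< {N = bound (suc m) + ∣ s ∣}
    (/-mono-< d 1 d 0
      (subst₂ ℕ._<_ (sym (*-identityʳ d)) (sym (*-identityˡ (suc d))) (n<1+n d)))
    (λ n large → maxγ-≤ s (<-≤-trans (<-≤-trans (∣t∣>0 s) (m≤n+m _ _)) large)
      (λ { t refl → γ-≤ s t d d (c-bound t D≡ large) }))

theorem4 : ((S : Tree) → Star S ⊎ BinaryCaterpillar S → J S ≈ fromℚ 1ℚ)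
    ×
    ((S : Tree) → ¬ Star S → ¬ BinaryCaterpillar S → J S < fromℚ 1ℚ)
theorem4 = attained , bounded
  where
  attained : (S : Tree) → Star S ⊎ BinaryCaterpillar S → J S ≈ fromℚ 1ℚ
  attained S (inj₁ S-star) with Star⇒star S-star
  ... | m , refl = Unavoidable⇒J≈1 (star m) (star-unavoidable m)
  attained S (inj₂ S-cat) with Caterpillar⇒≅cat S-cat
  ... | d , S≅cat = Unavoidable⇒J≈1 S (≅cat-unavoidable d S≅cat)

  bounded : (S : Tree) → ¬ Star S → ¬ BinaryCaterpillar S → J S < fromℚ 1ℚ
  -- The single-vertex tree is a caterpillar; any other tree has at least two leaves, which provides
  -- `m`.
  bounded leaf      _     ¬cat = contradiction leaf-Caterpillar ¬cat
  bounded (node ts) ¬star ¬cat = J<1 ¬star ¬cat (sym (m+[n∸m]≡n (2≤∣node∣ ts)))
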